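{- Let $TS$ be a process satisfying the effectiveness assumptions below. Given $s\in S$, it is decidable whether there exist a finite clique $S_0$-graph $\theta_0$, an $S$-graph $\theta$ with $\theta_0\xrightarrow{*}\theta$ using broadcast steps (so $\theta$ is a clique on the same vertex set), and a vertex of $\theta$ whose label $s'$ satisfies $s'\ge s$.
   Context: Fix a finite alphabet $\Sigma$; $\Sigma_b=\{!!a:a\in\Sigma\}$, $\Sigma_r=\{??a:a\in\Sigma\}$. A process is a labelled WSTS $(S,\Sigma_b\cup\Sigma_r,S_0,R,\le)$ with $S_0\subseteq S$ initial configurations and $\le$ a well-quasi-order on $S$ compatible with $R$ (if $s_1\le t_1$ and $(s_1,\lambda,s_2)\in R$ then some $t_2\ge s_2$ has $(t_1,\lambda,t_2)\in R$). Effectiveness assumptions: $TS$ is finitely branching and given by a finite set of labelled rules inducing $R$; $\le$ is decidable; for each label $\lambda$, from a finite basis of an upward-closed $I\subseteq S$ a finite basis of $\{s':(s',\lambda,s)\in R,\ s\in I\}$ is computable; for each rule the finite set of $\le$-minimal configurations enabling it is computable. An $S$-graph is a finite undirected graph $(V,E,L)$ without self-loops with $L:V\to S$; a clique $S$-graph is one whose underlying graph is complete. Broadcast step: $(V,E,L)\xrightarrow{a}(V,E,L')$ if there is $v$ with $(L(v),!!a,L'(v))\in R$, $(L(u),??a,L'(u))\in R$ for every neighbour $u$ of $v$, and all other labels unchanged. No reconfiguration of edges is allowed.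
   Formalization: Adds that every configuration can receive every message (else blocked broadcasts act as zero tests and cliques simulate counter machines) and that it is decidable whether a given s lies below some initial configuration (the English gives no effectiveness assumption on the initial set). -}

module Defs where

open import Data.Bool using (Bool; T)
open import Data.Fin using (Fin)
open import Data.List using (List; []; _∷_)
open import Data.List.Membership.Propositional using (_∈_)
open import Data.List.Relation.Unary.Any using (Any)
open import Data.Nat using (ℕ)
open import Data.Product using (Σ; Σ-syntax; ∃-syntax; _×_; _,_)
open import Data.Sum using (_⊎_)
open import Function.Bundles using (_⇔_)
open import Relation.Binary.Construct.Closure.ReflexiveTransitive using (Star)
open import Relation.Binary.Core using (Rel)
open import Relation.Binary.Definitions using (Decidable)
open import Relation.Binary.PropositionalEquality using (_≡_; _≢_)
open import Relation.Binary.Structures using (IsPreorder)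
open import Relation.Nullary using (¬_; Dec)
open import Relation.Unary using (Pred)
open import Level using (0ℓ)

-- The list is a reversed finite sequence (latest element first), and it is
-- good if an earlier element is below a later one.
data Good {S : Set} (_≤_ : Rel S 0ℓ) : List S → Set where
  here  : ∀ {x xs} → Any (_≤ x) xs → Good _≤_ (x ∷ xs)
  there : ∀ {x xs} → Good _≤_ xs → Good _≤_ (x ∷ xs)

-- However the sequence is extended, it eventually becomes good.
data Bar {S : Set} (_≤_ : Rel S 0ℓ) : List S → Set where
  now   : ∀ {xs} → Good _≤_ xs → Bar _≤_ xs
  later : ∀ {xs} → (∀ x → Bar _≤_ (x ∷ xs)) → Bar _≤_ xs

-- "Every infinite sequence has a good pair", in its inductive form.  The two
-- are equivalent classically (with dependent choice).  Constructively,
-- quantifying over functions ℕ → S would not express well-quasi-ordering: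
-- it would cover only the definable sequences, and Higman's lemma would be
-- unavailable without bar induction.
record IsWQO {S : Set} (_≤_ : Rel S 0ℓ) : Set where
  field
    isPreorder : IsPreorder _≡_ _≤_
    bar        : Bar _≤_ []

-- The alphabet is Fin n.
data Label (n : ℕ) : Set where
  !!_ : Fin n → Label n
  ??_ : Fin n → Label n

record Process (n : ℕ) : Set₁ where
  field
    S          : Set
    S₀         : Pred S 0ℓ
    R          : S → Label n → S → Set
    _≤_        : Rel S 0ℓ
    isWQO      : IsWQO _≤_
    compatible : ∀ {s₁ t₁ s₂ l} → s₁ ≤ t₁ → R s₁ l s₂ →
                 ∃[ t₂ ] (s₂ ≤ t₂ × R t₁ l t₂)

module _ {n : ℕ} (TS : Process n) where
  open Process TS

  ↑ : List S → Pred S 0ℓ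
  ↑ bs x = Any (_≤ x) bs

  IsBasis : List S → Pred S 0ℓ → Set
  IsBasis bs I = ∀ x → I x ⇔ ↑ bs x

  Pre : Label n → Pred S 0ℓ → Pred S 0ℓ
  Pre l I s′ = ∃[ s ] (R s′ l s × I s)

  -- For a quasi-order, "the" finite set of minimal elements is taken up to
  -- equivalence: it lists minimal elements of P, at least one below each
  -- element of P.
  record AreMinimal (ms : List S) (P : Pred S 0ℓ) : Set where
    field
      member   : ∀ {m} → m ∈ ms → P m
      minimal  : ∀ {m} → m ∈ ms → ∀ {x} → P x → x ≤ m → m ≤ x
      complete : ∀ {x} → P x → ↑ ms x

  -- Computability of a function is its existence as a function of type theory.
  record Effective : Set₁ where
    field
      _≤?_ : Decidable _≤_

      rules : ℕ
      label : Fin rules → Label n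
      post  : Fin rules → S → List S
      R⇔    : ∀ s l s′ →
              R s l s′ ⇔ (Σ[ r ∈ Fin rules ] (label r ≡ l × s′ ∈ post r s))

      pre       : Label n → List S → List S
      pre-basis : ∀ l bs (I : Pred S 0ℓ) → IsBasis bs I →
                  IsBasis (pre l bs) (Pre l I)

      minEnabling : Fin rules → List S
      enabling    : ∀ r →
                    AreMinimal (minEnabling r) (λ s → ∃[ s′ ] (s′ ∈ post r s))

      -- How the (possibly infinite) set of initial configurations is given.
      -- For a process without rules this is exactly the coverability problem,
      -- so nothing weaker suffices.  A finite list of initial configurations
      -- provides it, by _≤?_.
      ↓S₀? : ∀ s → Dec (∃[ s₀ ] (S₀ s₀ × s ≤ s₀))

  -- Every message can be received in every configuration.  A broadcast is
  -- blocked by a neighbour unable to receive it.  Without this condition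
  -- blocking would act on cliques as a zero test ("no vertex is in state c"),
  -- and finite-state processes ordered by equality could simulate Minsky
  -- machines, with counter values given by the number of vertices in a state.
  InputEnabled : Set
  InputEnabled = ∀ s a → ∃[ s′ ] R s (?? a) s′

record Graph : Set where
  field
    size   : ℕ
    edge   : Fin size → Fin size → Bool

  Vertex : Set
  Vertex = Fin size

  Adjacent : Rel Vertex 0ℓ
  Adjacent u v = T (edge u v)

  field
    symmetric : ∀ {u v} → Adjacent u v → Adjacent v u
    loopless  : ∀ {v} → ¬ Adjacent v v

  IsComplete : Set
  IsComplete = ∀ {u v} → u ≢ v → Adjacent u v

module _ {n : ℕ} (TS : Process n) where
  open Process TS
  open Graph

  Labelling : Graph → Set
  Labelling G = Vertex G → S

  SGraph : Set
  SGraph = Σ Graph Labelling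

  data _-[_]→_ : SGraph → Fin n → SGraph → Set where
    broadcast : ∀ {G : Graph} {L L′ : Labelling G} {a} (v : Vertex G) →
                R (L v) (!! a) (L′ v) →
                (∀ u → Adjacent G v u → R (L u) (?? a) (L′ u)) →
                (∀ u → u ≢ v → ¬ Adjacent G v u → L′ u ≡ L u) →
                (G , L) -[ a ]→ (G , L′)

  _→*_ : Rel SGraph 0ℓ
  _→*_ = Star (λ θ θ′ → ∃[ a ] (θ -[ a ]→ θ′))

  IsClique : Pred SGraph 0ℓ
  IsClique (G , _) = IsComplete G

  IsInitial : Pred SGraph 0ℓ
  IsInitial (_ , L) = ∀ v → S₀ (L v)

  HasLabelAbove : S → Pred SGraph 0ℓ
  HasLabelAbove s (G , L) = Σ[ v ∈ Vertex G ] (s ≤ L v)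

  CliqueCoverable : S → Set
  CliqueCoverable s =
    ∃[ θ₀ ] ∃[ θ ] (IsClique θ₀ × IsInitial θ₀ × θ₀ →* θ × HasLabelAbove s θ)

{-# OPTIONS --safe #-}

-- A clique configuration is a word of process configurations, ordered by
-- embedding.  This is a well-quasi-order by Higman's lemma, and since vertices
-- outside the image of an embedding can always receive, it is compatible with
-- broadcasts.  Hence coverability is decided by saturating backwards from the
-- one-letter word s: finite bases of predecessors are assembled letterwise,
-- except that the sender may be a vertex not yet mentioned by the basis element.
module Submission where

open import Data.Bool using (T; not)
open import Data.Empty using (⊥-elim)
open import Data.Fin using (Fin; zero; suc)
import Data.Fin.Properties as Fin
open import Data.List using (List; []; _∷_; _++_; allFin; cartesianProductWith; concatMap;
  filter; length; lookup; tabulate)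
open import Data.List.Membership.Propositional using (_∈_; find; lose)
open import Data.List.Membership.Propositional.Properties using
  (∈-allFin; ∈-lookup; ∈-filter⁺; ∈-filter⁻; ∈-cartesianProductWith⁻)
open import Data.List.Properties using (tabulate-lookup)
open import Data.List.Relation.Binary.Pointwise as Pointwise using (Pointwise; []; _∷_)
open import Data.List.Relation.Binary.Sublist.Heterogeneous using (Sublist; []; _∷_; _∷ʳ_; minimum)
import Data.List.Relation.Binary.Sublist.Heterogeneous.Properties as Sublist
open import Data.List.Relation.Binary.Subset.Propositional using (_⊆_)
open import Data.List.Relation.Unary.All as All using (All; []; _∷_)
import Data.List.Relation.Unary.All.Properties as All
open import Data.List.Relation.Unary.Any as Any using (Any; here; there)
import Data.List.Relation.Unary.Any.Properties as Any
open import Data.Nat using (ℕ)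
open import Data.Product using (∃-syntax; _×_; _,_; proj₁; proj₂)
open import Data.Product.Relation.Binary.Pointwise.NonDependent using () renaming (Pointwise to Pairwise)
open import Data.Sum as Sum using (_⊎_; inj₁; inj₂; [_,_]′)
import Data.Vec.Functional as Vector
open import Function using (_∘_; id)
open import Function.Bundles using (module Equivalence; mk⇔)
open import Level using (0ℓ)
open import Relation.Binary.Construct.Closure.ReflexiveTransitive using (ε; _◅_; _◅◅_)
open import Relation.Binary.Core using (Rel)
open import Relation.Binary.Definitions using (Decidable; Reflexive; Transitive)
open import Relation.Binary.PropositionalEquality using (_≡_; _≢_; refl; sym; cong; subst)
open import Relation.Binary.Structures using (IsPreorder)
open import Relation.Nullary using (¬_; Dec; yes; no; does)
open import Relation.Nullary.Decidable using (map′)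
open import Relation.Unary using (Pred; U)
import Relation.Unary as Unary
open import Defs

-- Well-quasi-orders on subsets and their closure properties.

residual : {A : Set} → Rel A 0ℓ → Pred A 0ℓ → A → Pred A 0ℓ
residual _≤_ P x y = P y × ¬ x ≤ y

-- Well-quasi-ordering of a subset as well-foundedness under passing to
-- residuals: unlike Bar, this form is closed under unions, products and
-- images by direct nested inductions.
data WqoOn {A : Set} (_≤_ : Rel A 0ℓ) (P : Pred A 0ℓ) : Set₁ where
  residuals : (∀ {x} → P x → WqoOn _≤_ (residual _≤_ P x)) → WqoOn _≤_ P

module _ {A : Set} {_≤_ : Rel A 0ℓ} where

  -- Induction on the bar: `P` holds only elements that keep the bad sequence `xs` bad, and choosing
  -- one of them extends the sequence by it.
  bar⇒wqoOn : ∀ {xs P} → Bar _≤_ xs → ¬ Good _≤_ xs →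
              (∀ {x} → P x → ¬ Any (_≤ x) xs) → WqoOn _≤_ P
  bar⇒wqoOn (now good)  bad _     = ⊥-elim (bad good)
  bar⇒wqoOn (later bar) bad fresh = residuals λ {x} px →
    bar⇒wqoOn (bar x)
      (λ { (here below) → fresh px below ; (there good) → bad good })
      (λ { (_ , x≰y) (here x≤y) → x≰y x≤y ; (py , _) (there below) → fresh py below })

  -- A chosen element lies in `P` or in `Q`; passing to the residual shrinks that part and leaves
  -- the other, so induction on both proofs applies.
  wqoOn-∪ : ∀ {P Q V} → WqoOn _≤_ P → WqoOn _≤_ Q →
            (∀ {x} → V x → P x ⊎ Q x) → WqoOn _≤_ V
  wqoOn-∪ {P} {Q} {V} wp@(residuals f) wq@(residuals g) split = residuals λ vx → part (split vx)
    where
    part : ∀ {x} → P x ⊎ Q x → WqoOn _≤_ (residual _≤_ V x)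
    part (inj₁ px) = wqoOn-∪ (f px) wq λ { (vy , x≰y) → [ (λ py → inj₁ (py , x≰y)) , inj₂ ]′ (split vy) }
    part (inj₂ qx) = wqoOn-∪ wp (g qx) λ { (vy , x≰y) → [ inj₁ , (λ qy → inj₂ (qy , x≰y)) ]′ (split vy) }

-- By monotonicity, a preimage of a point in the residual by `f x` lies in the residual by `x`. The
-- induction thus follows preimages of the chosen elements.
wqoOn-image : {A B : Set} {_≤_ : Rel A 0ℓ} {_≼_ : Rel B 0ℓ} {P : Pred A 0ℓ} {Q : Pred B 0ℓ}
              (f : A → B) → (∀ {x y} → x ≤ y → f x ≼ f y) →
              (∀ {y} → Q y → ∃[ x ] (P x × f x ≡ y)) →
              WqoOn _≤_ P → WqoOn _≼_ Q
wqoOn-image {_≤_ = _≤_} {_≼_} {P} {Q} f mono onto (residuals w) = residuals λ qy → part qy (onto qy)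
  where
  part : ∀ {y} → Q y → ∃[ x ] (P x × f x ≡ y) → WqoOn _≼_ (residual _≼_ Q y)
  part _ (x , px , refl) = wqoOn-image f mono onto′ (w px)
    where
    onto′ : ∀ {z} → residual _≼_ Q (f x) z → ∃[ x′ ] (residual _≤_ P x x′ × f x′ ≡ z)
    onto′ (qz , fx⋠z) with onto qz
    ... | x′ , px′ , refl = x′ , (px′ , fx⋠z ∘ mono) , refl

-- A pair not above `(x , y)` fails in one coordinate, and `_≤?_` tells which, so the residual is
-- covered by two smaller products.
wqoOn-× : {A B : Set} {_≤_ : Rel A 0ℓ} {_≼_ : Rel B 0ℓ} → Decidable _≤_ →
          {P : Pred A 0ℓ} {Q : Pred B 0ℓ} → WqoOn _≤_ P → WqoOn _≼_ Q →
          WqoOn (Pairwise _≤_ _≼_) (λ z → P (proj₁ z) × Q (proj₂ z))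
wqoOn-× {_≤_ = _≤_} {_≼_} _≤?_ {P} {Q} wp@(residuals f) wq@(residuals g) = residuals λ { (px , qy) →
  wqoOn-∪ (wqoOn-× _≤?_ (f px) wq) (wqoOn-× _≤?_ wp (g qy)) split }
  where
  split : ∀ {x y z} →
          residual (Pairwise _≤_ _≼_) (λ z → P (proj₁ z) × Q (proj₂ z)) (x , y) z →
          (residual _≤_ P x (proj₁ z) × Q (proj₂ z)) ⊎ (P (proj₁ z) × residual _≼_ Q y (proj₂ z))
  split {x} {z = x′ , _} ((px′ , qy′) , ≰) with x ≤? x′
  ... | yes x≤x′ = inj₂ (px′ , qy′ , λ y≼y′ → ≰ (x≤x′ , y≼y′))
  ... | no  x≰x′ = inj₁ ((px′ , x≰x′) , qy′)

-- Higman's lemma.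

module Higman {A : Set} {_≤_ : Rel A 0ℓ} (_≤?_ : Decidable _≤_) where

  Factors : Pred A 0ℓ → A → List A → Pred (List A × A × List A) 0ℓ
  Factors P x u (v , y , w) = All (residual _≤_ P x) v × P y × residual (Sublist _≤_) (All P) u w

  join : List A × A × List A → List A
  join (v , y , w) = v ++ y ∷ w

  -- The word is cut at its first letter above x.
  factorise : ∀ {P x u w} → residual (Sublist _≤_) (All P) (x ∷ u) w →
              All (residual _≤_ P x) w ⊎ ∃[ z ] (Factors P x u z × join z ≡ w)
  factorise {w = []} _ = inj₁ []
  factorise {x = x} {w = y ∷ w} (py ∷ pw , ⋢) with x ≤? y
  ... | yes x≤y = inj₂ (([] , y , w) , ([] , py , pw , λ u⊑w → ⋢ (x≤y ∷ u⊑w)) , refl)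
  ... | no  x≰y with factorise (pw , λ ⊑w → ⋢ (y ∷ʳ ⊑w))
  ...   | inj₁ pw′ = inj₁ ((py , x≰y) ∷ pw′)
  ...   | inj₂ ((v , z) , (pv , pz) , refl) = inj₂ ((y ∷ v , z) , ((py , x≰y) ∷ pv , pz) , refl)

  mutual
    higman : ∀ {P} → WqoOn _≤_ P → WqoOn (Sublist _≤_) (All P)
    higman wp = residuals λ {u} pu → avoiding wp u pu

    -- Outer induction on the wqo proof, inner induction on `u`. A word avoiding `x ∷ u` either has
    -- all its letters in the residual by `x` or is the join of a triple in `Factors`. The outer
    -- induction handles the first component of the triple, the inner one the third.
    avoiding : ∀ {P} → WqoOn _≤_ P → ∀ u → All P u →
               WqoOn (Sublist _≤_) (residual (Sublist _≤_) (All P) u)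
    avoiding wp [] [] = residuals λ { (_ , ⋢) → ⊥-elim (⋢ (minimum _)) }
    avoiding wp@(residuals f) (x ∷ u) (px ∷ pu) =
      wqoOn-∪ (higman (f px))
        (wqoOn-image join (λ { (v⊑ , y≤ , w⊑) → Sublist.++⁺ v⊑ (y≤ ∷ w⊑) }) id
          (wqoOn-× (Sublist.sublist? _≤?_) (higman (f px)) (wqoOn-× _≤?_ wp (avoiding wp u pu))))
        factorise

-- Backward search by saturation.

module BackwardSearch {A : Set} {_≤_ : Rel A 0ℓ} (_≤?_ : Decidable _≤_) (≤-refl : Reflexive _≤_)
  {Init : Pred A 0ℓ} (init? : Unary.Decidable Init) (preds : A → List A) where

  data Reached : Pred A 0ℓ where
    initial : ∀ {x} → Init x → Reached x
    step    : ∀ {x} → Any Reached (preds x) → Reached x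

  Above : List A → Pred A 0ℓ
  Above vs x = Any (_≤ x) vs

  Expanded : List A → Pred A 0ℓ
  Expanded vs x = ¬ Init x × All (Above vs) (preds x)

  -- With nothing visited, this certifies a negative answer: no basis element is initial, and the
  -- predecessors of each are above the basis. Visited elements are exempt because their expansion
  -- is still owed by the enclosing calls of `search`.
  record Saturation (visited work : List A) : Set where
    field
      basis    : List A
      extends  : visited ⊆ basis
      covers   : All (Above basis) work
      expanded : ∀ {x} → x ∈ basis → x ∈ visited ⊎ Expanded basis x

  open Saturation

  skip : ∀ {vs x ws} → Above vs x → Saturation vs ws → Saturation vs (x ∷ ws)
  skip above sat = record
    { basis    = basis sat
    ; extends  = extends sat
    ; covers   = let _ , v∈vs , v≤x = find above in lose (extends sat v∈vs) v≤x ∷ covers sat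
    ; expanded = expanded sat
    }

  expand : ∀ {vs x ws} → ¬ Init x → Saturation (x ∷ vs) (preds x ++ ws) → Saturation vs (x ∷ ws)
  expand {x = x} ¬init sat = record
    { basis    = basis sat
    ; extends  = extends sat ∘ there
    ; covers   = lose (extends sat (here refl)) ≤-refl ∷ All.++⁻ʳ (preds x) (covers sat)
    ; expanded = λ y∈ → case (expanded sat y∈)
    }
    where
    case : ∀ {y vs} → y ∈ x ∷ vs ⊎ Expanded (basis sat) y → y ∈ vs ⊎ Expanded (basis sat) y
    -- The debt for `x` is paid: its predecessors headed the work list, so they are covered.
    case (inj₁ (here refl)) = inj₂ (¬init , All.++⁻ˡ (preds x) (covers sat))
    case (inj₁ (there y∈))  = inj₁ y∈
    case (inj₂ exp)         = inj₂ exp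

  -- `P` holds the room left: an item of the work list is above a visited element and can be
  -- skipped, or it lies in `P`, and visiting it shrinks `P` to a residual. Termination is
  -- lexicographic in the wqo proof and the work list.
  search : ∀ {P} → WqoOn _≤_ P → ∀ vs ws → (∀ x → P x ⊎ Above vs x) →
           Any Reached ws ⊎ Saturation vs ws
  search _ vs [] _ = inj₂ record { basis = vs ; extends = id ; covers = [] ; expanded = inj₁ }
  -- The recursive call is passed to visit, rather than made there, because
  -- wqo must stay visibly unchanged for the termination checker.
  search {P} wqo@(residuals f) vs (x ∷ ws) fresh = visit (fresh x) (search wqo vs ws fresh)
    where
    fresh′ : ∀ y → residual _≤_ P x y ⊎ Above (x ∷ vs) y
    fresh′ y with x ≤? y | fresh y
    ... | yes x≤y | _          = inj₂ (here x≤y)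
    ... | no  x≰y | inj₁ py    = inj₁ (py , x≰y)
    ... | no  x≰y | inj₂ above = inj₂ (there above)

    visit : P x ⊎ Above vs x → Any Reached ws ⊎ Saturation vs ws →
            Any Reached (x ∷ ws) ⊎ Saturation vs (x ∷ ws)
    visit (inj₂ above) rest = Sum.map there (skip above) rest
    visit (inj₁ px) _ with init? x
    ... | yes init = inj₁ (here (initial init))
    ... | no ¬init = Sum.map ([ (λ reached → here (step reached)) , there ]′ ∘ Any.++⁻ (preds x)) (expand ¬init)
                       (search (f px) (x ∷ vs) (preds x ++ ws) fresh′)

-- Equality of labels, and complete graphs.

_≟_ : ∀ {n} → Decidable {A = Label n} _≡_
(!! a) ≟ (!! b) = map′ (cong !!_) (λ { refl → refl }) (a Fin.≟ b)
(?? a) ≟ (?? b) = map′ (cong ??_) (λ { refl → refl }) (a Fin.≟ b)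
(!! a) ≟ (?? b) = no λ ()
(?? a) ≟ (!! b) = no λ ()

module _ {k : ℕ} (u v : Fin k) where

  T⇒≢ : T (not (does (u Fin.≟ v))) → u ≢ v
  T⇒≢ t with u Fin.≟ v
  ... | no u≢v = u≢v

  ≢⇒T : u ≢ v → T (not (does (u Fin.≟ v)))
  ≢⇒T u≢v with u Fin.≟ v
  ... | yes u≡v = u≢v u≡v
  ... | no  _   = _

complete : ℕ → Graph
complete k = record
  { size      = k
  ; edge      = λ u v → not (does (u Fin.≟ v))
  ; symmetric = λ {u} {v} uv → ≢⇒T v u (T⇒≢ u v uv ∘ sym)
  ; loopless  = λ {v} vv → T⇒≢ v v vv refl
  }

complete-isComplete : ∀ k → Graph.IsComplete (complete k)
complete-isComplete k = ≢⇒T _ _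

-- Words of configurations and their broadcast steps.

module _ {n : ℕ} (TS : Process n) (eff : Effective TS) (inputEnabled : InputEnabled TS) where
  open Process TS
  open Effective eff
  open Equivalence using (to; from)
  open IsPreorder (IsWQO.isPreorder isWQO) using () renaming (refl to ≤-refl; trans to ≤-trans)

  _⊑_ : Rel (List S) 0ℓ
  _⊑_ = Sublist _≤_

  ⊑-refl : Reflexive _⊑_
  ⊑-refl {[]}     = []
  ⊑-refl {x ∷ xs} = ≤-refl ∷ ⊑-refl

  ⊑-trans : Transitive _⊑_
  ⊑-trans = Sublist.trans ≤-trans

  _⊑?_ : Decidable _⊑_
  _⊑?_ = Sublist.sublist? _≤?_

  ⊑-wqoOn : WqoOn _⊑_ (All U)
  ⊑-wqoOn = Higman.higman _≤?_ (bar⇒wqoOn (IsWQO.bar isWQO) (λ ()) (λ _ ()))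

  Receive : Fin n → Rel (List S) 0ℓ
  Receive a = Pointwise (λ x y → R x (?? a) y)

  -- No edges are recorded: in a clique the sender is adjacent to all other vertices, so one letter
  -- sends and all others receive.
  data Step (a : Fin n) : Rel (List S) 0ℓ where
    send    : ∀ {x y xs ys} → R x (!! a) y → Receive a xs ys → Step a (x ∷ xs) (y ∷ ys)
    receive : ∀ {x y xs ys} → R x (?? a) y → Step a xs ys → Step a (x ∷ xs) (y ∷ ys)

  -- Finite bases of predecessors.

  pre⁺ : ∀ {l x y z} → R x l y → z ≤ y → Any (_≤ x) (pre l (z ∷ []))
  pre⁺ {l} {x} {y} {z} r z≤y = to (pre-basis l (z ∷ []) _ (λ _ → mk⇔ id id) x) (y , r , here z≤y)

  pre⁻ : ∀ {l x z w} → w ∈ pre l (z ∷ []) → w ≤ x → ∃[ y ] (R x l y × z ≤ y)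
  pre⁻ {l} {x} {z} w∈ w≤x with from (pre-basis l (z ∷ []) _ (λ _ → mk⇔ id id) x) (lose w∈ w≤x)
  ... | y , r , here z≤y = y , r , z≤y

  -- A basis of the configurations with some transition labelled `l`, whatever its target.
  enablers : Label n → List S
  enablers l = concatMap minEnabling (filter (λ r → label r ≟ l) (allFin rules))

  enablers⁺ : ∀ {l x y} → R x l y → Any (_≤ x) (enablers l)
  enablers⁺ {l} {x} {y} xly with to (R⇔ x l y) xly
  ... | r , l≡ , y∈ = Any.concatMap⁺ minEnabling
    (lose (∈-filter⁺ (λ r → label r ≟ l) (∈-allFin r) l≡) (AreMinimal.complete (enabling r) (y , y∈)))

  enablers⁻ : ∀ {l x w} → w ∈ enablers l → w ≤ x → ∃[ y ] R x l y
  enablers⁻ {l} {x} {w} w∈ w≤x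
    with find (Any.concatMap⁻ minEnabling {xs = filter (λ r → label r ≟ l) (allFin rules)} w∈)
  ... | r , r∈ , w∈r with ∈-filter⁻ (λ r → label r ≟ l) {xs = allFin rules} r∈ | AreMinimal.member (enabling r) w∈r
  ...   | _ , l≡ | z , z∈ with compatible w≤x (from (R⇔ w l z) (r , l≡ , z∈))
  ...     | y , _ , xly = y , xly

  infixr 6 _⊗_

  -- Opaque so that the factors of a product can be inferred from it.
  opaque
    _⊗_ : List S → List (List S) → List (List S)
    ws ⊗ wss = cartesianProductWith _∷_ ws wss

    product⁺ : ∀ {x xs ws wss} → Any (_≤ x) ws → Any (_⊑ xs) wss →
               Any (_⊑ (x ∷ xs)) (ws ⊗ wss)
    product⁺ = Any.cartesianProductWith⁺ _∷_ _∷_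

    product⁻ : ∀ {w ws us wss} → (w ∷ ws) ∈ us ⊗ wss → w ∈ us × ws ∈ wss
    product⁻ {us = us} {wss} ws∈ with ∈-cartesianProductWith⁻ _∷_ us wss ws∈
    ... | _ , _ , w∈ , ws∈′ , refl = w∈ , ws∈′

    []∉product : ∀ {us wss} → ¬ [] ∈ us ⊗ wss
    []∉product {us} {wss} []∈ with ∈-cartesianProductWith⁻ _∷_ us wss []∈
    ... | _ , _ , _ , _ , ()

  -- Only vertices matched with a letter of the target are listed; all others can receive by
  -- `inputEnabled`. Hence the empty word alone is the basis for the empty target.
  preReceive : Fin n → List S → List (List S)
  preReceive a []       = [] ∷ []
  preReceive a (z ∷ zs) = pre (?? a) (z ∷ []) ⊗ preReceive a zs

  mutual
    -- The first summand is for a sender that is matched with no letter of zs;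
    -- such a sender further down is inserted by the recursive call.
    preStep : Fin n → List S → List (List S)
    preStep a zs = enablers (!! a) ⊗ preReceive a zs ++ preStepMatched a zs

    preStepMatched : Fin n → List S → List (List S)
    preStepMatched a []       = []
    preStepMatched a (z ∷ zs) =
      pre (!! a) (z ∷ []) ⊗ preReceive a zs ++
      pre (?? a) (z ∷ []) ⊗ preStep a zs

  preReceive⁺ : ∀ {a xs ys zs} → Receive a xs ys → zs ⊑ ys → Any (_⊑ xs) (preReceive a zs)
  preReceive⁺ []       []           = here []
  preReceive⁺ (_ ∷ rs) (_ ∷ʳ zs⊑ys) = Any.map (_ ∷ʳ_) (preReceive⁺ rs zs⊑ys)
  preReceive⁺ (r ∷ rs) (z≤y ∷ zs⊑ys) = product⁺ (pre⁺ r z≤y) (preReceive⁺ rs zs⊑ys)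

  preReceive⁻ : ∀ {a zs ws xs} → ws ∈ preReceive a zs → ws ⊑ xs →
                ∃[ ys ] (Receive a xs ys × zs ⊑ ys)
  preReceive⁻ {a} ws∈ (x ∷ʳ ws⊑xs) =
    let y , r = inputEnabled x a ; ys , rs , zs⊑ys = preReceive⁻ ws∈ ws⊑xs
    in y ∷ ys , r ∷ rs , y ∷ʳ zs⊑ys
  preReceive⁻ {zs = []}     (here refl) [] = [] , [] , []
  preReceive⁻ {zs = []}     (here ())   (_ ∷ _)
  preReceive⁻ {zs = z ∷ zs} ws∈ [] = ⊥-elim ([]∉product ws∈)
  preReceive⁻ {zs = z ∷ zs} ws∈ (w≤x ∷ ws⊑xs) =
    let w∈ , ws∈′ = product⁻ ws∈
        y , r , z≤y = pre⁻ w∈ w≤x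
        ys , rs , zs⊑ys = preReceive⁻ ws∈′ ws⊑xs
    in y ∷ ys , r ∷ rs , z≤y ∷ zs⊑ys

  preStep⁺ : ∀ {a xs ys zs} → Step a xs ys → zs ⊑ ys → Any (_⊑ xs) (preStep a zs)
  -- The sender's new label is matched with no letter of `zs`, so it only has to be able to send.
  preStep⁺ (send r rs) (_ ∷ʳ zs⊑ys) = Any.++⁺ˡ (product⁺ (enablers⁺ r) (preReceive⁺ rs zs⊑ys))
  preStep⁺ {a} {zs = zs} (send r rs) (z≤y ∷ zs⊑ys) =
    Any.++⁺ʳ (enablers (!! a) ⊗ preReceive a zs)
      (Any.++⁺ˡ (product⁺ (pre⁺ r z≤y) (preReceive⁺ rs zs⊑ys)))
  preStep⁺ (receive r st) (_ ∷ʳ zs⊑ys) = Any.map (_ ∷ʳ_) (preStep⁺ st zs⊑ys)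
  preStep⁺ {a} {zs = z ∷ zs} (receive r st) (z≤y ∷ zs⊑ys) =
    Any.++⁺ʳ (enablers (!! a) ⊗ preReceive a (z ∷ zs))
      (Any.++⁺ʳ (pre (!! a) (z ∷ []) ⊗ preReceive a zs)
        (product⁺ (pre⁺ r z≤y) (preStep⁺ st zs⊑ys)))

  preStep⁻ : ∀ {a zs ws xs} → ws ∈ preStep a zs → ws ⊑ xs → ∃[ ys ] (Step a xs ys × zs ⊑ ys)
  preStep⁻ {a} ws∈ (x ∷ʳ ws⊑xs) =
    let y , r = inputEnabled x a ; ys , st , zs⊑ys = preStep⁻ ws∈ ws⊑xs
    in y ∷ ys , receive r st , y ∷ʳ zs⊑ys
  -- Every word in `preStep a zs` contains a sender, so none is empty.
  preStep⁻ {a} {zs} ws∈ [] with Any.++⁻ (enablers (!! a) ⊗ preReceive a zs) ws∈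
  ... | inj₁ ∈new = ⊥-elim ([]∉product ∈new)
  preStep⁻ {a} {z ∷ zs} ws∈ [] | inj₂ ∈matched
    with Any.++⁻ (pre (!! a) (z ∷ []) ⊗ preReceive a zs) ∈matched
  ... | inj₁ ∈send    = ⊥-elim ([]∉product ∈send)
  ... | inj₂ ∈receive = ⊥-elim ([]∉product ∈receive)
  preStep⁻ {a} {zs} ws∈ (w≤x ∷ ws⊑xs)
    with Any.++⁻ (enablers (!! a) ⊗ preReceive a zs) ws∈
  ... | inj₁ ∈new =
    let w∈ , ws∈′ = product⁻ ∈new
        y , r = enablers⁻ w∈ w≤x
        ys , rs , zs⊑ys = preReceive⁻ ws∈′ ws⊑xs
    in y ∷ ys , send r rs , y ∷ʳ zs⊑ys
  preStep⁻ {a} {z ∷ zs} ws∈ (w≤x ∷ ws⊑xs) | inj₂ ∈matched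
    with Any.++⁻ (pre (!! a) (z ∷ []) ⊗ preReceive a zs) ∈matched
  ... | inj₁ ∈send =
    let w∈ , ws∈′ = product⁻ ∈send
        y , r , z≤y = pre⁻ w∈ w≤x
        ys , rs , zs⊑ys = preReceive⁻ ws∈′ ws⊑xs
    in y ∷ ys , send r rs , z≤y ∷ zs⊑ys
  ... | inj₂ ∈receive =
    let w∈ , ws∈′ = product⁻ ∈receive
        y , r , z≤y = pre⁻ w∈ w≤x
        ys , st , zs⊑ys = preStep⁻ ws∈′ ws⊑xs
    in y ∷ ys , receive r st , z≤y ∷ zs⊑ys

  preds : List S → List (List S)
  preds zs = concatMap (λ a → preStep a zs) (allFin n)

  preds⁺ : ∀ {a xs ys zs} → Step a xs ys → zs ⊑ ys → Any (_⊑ xs) (preds zs)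
  preds⁺ {a} {zs = zs} st zs⊑ys =
    Any.concatMap⁺ (λ a → preStep a zs) (lose (∈-allFin a) (preStep⁺ st zs⊑ys))

  -- The words that embed in some word over `S₀`, that is, those whose upward closure meets the
  -- initial words.
  Initial : Pred (List S) 0ℓ
  Initial = All (λ x → ∃[ s₀ ] (S₀ s₀ × x ≤ s₀))

  Initial-⊑ : ∀ {xs ys} → All S₀ ys → xs ⊑ ys → Initial xs
  Initial-⊑ []         []           = []
  Initial-⊑ (_ ∷ init) (_ ∷ʳ xs⊑ys) = Initial-⊑ init xs⊑ys
  Initial-⊑ (s ∷ init) (x≤y ∷ xs⊑ys) = (_ , s , x≤y) ∷ Initial-⊑ init xs⊑ys

  Initial⇒⊑ : ∀ {xs} → Initial xs → ∃[ ys ] (All S₀ ys × xs ⊑ ys)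
  Initial⇒⊑ [] = [] , [] , []
  Initial⇒⊑ ((s₀ , s , x≤s₀) ∷ init) =
    let ys , ss , xs⊑ys = Initial⇒⊑ init in s₀ ∷ ys , s ∷ ss , x≤s₀ ∷ xs⊑ys

  -- Steps on words versus broadcasts on cliques.

  tabulate-step : ∀ {k a} {L L′ : Fin k → S} v → R (L v) (!! a) (L′ v) →
                  (∀ u → u ≢ v → R (L u) (?? a) (L′ u)) → Step a (tabulate L) (tabulate L′)
  tabulate-step zero    r rs = send r (Pointwise.tabulate⁺ (λ u → rs (suc u) λ ()))
  tabulate-step (suc v) r rs =
    receive (rs zero λ ()) (tabulate-step v r (λ u u≢v → rs (suc u) (u≢v ∘ Fin.suc-injective)))

  -- The labelling `L` is kept as given and only the words are equated, so that steps compose into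
  -- runs without function extensionality.
  receive-tabulate : ∀ {k a ys} (L : Fin k → S) → Receive a (tabulate L) ys →
                     ∃[ L′ ] ((∀ u → R (L u) (?? a) (L′ u)) × tabulate L′ ≡ ys)
  receive-tabulate {ℕ.zero}  L [] = (λ ()) , (λ ()) , refl
  receive-tabulate {ℕ.suc k} L (_∷_ {y = y} r rs) with receive-tabulate (L ∘ suc) rs
  ... | L′ , recv , refl = y Vector.∷ L′ , (λ { zero → r ; (suc u) → recv u }) , refl

  step-tabulate : ∀ {k a ys} (L : Fin k → S) → Step a (tabulate L) ys →
                  ∃[ L′ ] ∃[ v ] (R (L v) (!! a) (L′ v) ×
                                  (∀ u → u ≢ v → R (L u) (?? a) (L′ u)) × tabulate L′ ≡ ys)
  step-tabulate {ℕ.suc k} L (send {y = y} r rs) with receive-tabulate (L ∘ suc) rs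
  ... | L′ , recv , refl = y Vector.∷ L′ , zero , r ,
    (λ { zero 0≢0 → ⊥-elim (0≢0 refl) ; (suc u) _ → recv u }) , refl
  step-tabulate {ℕ.suc k} L (receive {y = y} r st) with step-tabulate (L ∘ suc) st
  ... | L′ , v , r′ , recv , refl = y Vector.∷ L′ , suc v , r′ ,
    (λ { zero _ → r ; (suc u) u≢v → recv u (u≢v ∘ cong suc) }) , refl

  broadcast-clique : ∀ {k a ys} (L : Fin k → S) → Step a (tabulate L) ys →
                     ∃[ L′ ] (_-[_]→_ TS (complete k , L) a (complete k , L′) × tabulate L′ ≡ ys)
  broadcast-clique {k} L st with step-tabulate L st
  ... | L′ , v , r , recv , refl = L′ ,
    broadcast v r
      (λ u v~u → recv u λ { refl → Graph.loopless (complete k) {v} v~u })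
      -- A clique has no vertices whose labels must stay unchanged.
      (λ u u≢v v≁u → ⊥-elim (v≁u (complete-isComplete k (u≢v ∘ sym)))) ,
    refl

  clique-broadcast : ∀ {G a} {L L′ : Labelling TS G} → Graph.IsComplete G →
                     _-[_]→_ TS (G , L) a (G , L′) → Step a (tabulate L) (tabulate L′)
  clique-broadcast clique (broadcast v r rs _) = tabulate-step v r (λ u u≢v → rs u (clique (u≢v ∘ sym)))

  -- Correctness of the search, and the decision procedure.

  open BackwardSearch _⊑?_ ⊑-refl (All.all? ↓S₀?) preds

  Covered : List S → Set
  Covered zs = ∃[ k ] ∃[ L₀ ] ∃[ L ]
    ((∀ v → S₀ (L₀ v)) × _→*_ TS (complete k , L₀) (complete k , L) × zs ⊑ tabulate L)

  -- One backward step of the search becomes one broadcast appended at the end of the run.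
  covered-step : ∀ {a zs ws} → ws ∈ preStep a zs → Covered ws → Covered zs
  covered-step ws∈ (k , L₀ , L , init , steps , ws⊑) with preStep⁻ ws∈ ws⊑
  ... | ys , st , zs⊑ys with broadcast-clique L st
  ...   | L′ , st′ , refl = k , L₀ , L′ , init , steps ◅◅ ((_ , st′) ◅ ε) , zs⊑ys

  mutual
    reached⇒covered : ∀ {zs} → Reached zs → Covered zs
    reached⇒covered (initial init) with Initial⇒⊑ init
    -- The run is empty, on the clique whose vertices are the positions of `ys`.
    ... | ys , ss , zs⊑ys = length ys , lookup ys , lookup ys , (λ v → All.lookup ss (∈-lookup v)) , ε ,
      subst (_ ⊑_) (sym (tabulate-lookup ys)) zs⊑ys
    reached⇒covered {zs} (step reached) =
      let _ , ws∈ , covered = any-covered reached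
          _ , _ , ws∈a = find (Any.concatMap⁻ (λ a → preStep a zs) {xs = allFin n} ws∈)
      in covered-step ws∈a covered

    any-covered : ∀ {wss} → Any Reached wss → ∃[ ws ] (ws ∈ wss × Covered ws)
    any-covered (here reached)  = _ , here refl , reached⇒covered reached
    any-covered (there reached) = let ws , ws∈ , covered = any-covered reached in ws , there ws∈ , covered

  module _ {work : List (List S)} (sat : Saturation [] work) where
    open Saturation sat

    ¬initial-above : ∀ {ys} → All S₀ ys → ¬ Above basis ys
    ¬initial-above init above with find above
    ... | ws , ws∈ , ws⊑ys with expanded ws∈
    -- The other alternative is void since nothing was visited at the start.
    ...   | inj₂ (¬init , _) = ¬init (Initial-⊑ init ws⊑ys)

    above-backwards : ∀ {a xs ys} → Step a xs ys → Above basis ys → Above basis xs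
    above-backwards st above with find above
    ... | ws , ws∈ , ws⊑ys with expanded ws∈
    ...   | inj₂ (_ , closed) =
      let _ , p∈ , p⊑xs = find (preds⁺ st ws⊑ys)
      in Any.map (λ q⊑p → ⊑-trans q⊑p p⊑xs) (All.lookup closed p∈)

    -- The upward closure of `basis` is closed under predecessors and contains no initial word, so a
    -- run ending in it could be traced back to a contradiction.
    unreachable : ∀ {θ₀ θ} → IsClique TS θ₀ → IsInitial TS θ₀ → _→*_ TS θ₀ θ →
                  ¬ Above basis (tabulate (proj₂ θ))
    unreachable clique init steps above = ¬initial-above (All.tabulate⁺ init) (backwards clique steps above)
      where
      backwards : ∀ {θ₀ θ} → IsClique TS θ₀ → _→*_ TS θ₀ θ →
                  Above basis (tabulate (proj₂ θ)) → Above basis (tabulate (proj₂ θ₀))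
      backwards _ ε above = above
      -- Matching on `broadcast` shows that the graph is unchanged, so `clique` applies to the rest
      -- of the run.
      backwards clique ((_ , st@(broadcast _ _ _ _)) ◅ steps) above =
        above-backwards (clique-broadcast clique st) (backwards clique steps above)

  singleton-⊑⁺ : ∀ {k s} {L : Fin k → S} v → s ≤ L v → (s ∷ []) ⊑ tabulate L
  singleton-⊑⁺ zero    s≤ = s≤ ∷ minimum _
  singleton-⊑⁺ (suc v) s≤ = _ ∷ʳ singleton-⊑⁺ v s≤

  singleton-⊑⁻ : ∀ {k s} {L : Fin k → S} → (s ∷ []) ⊑ tabulate L → ∃[ v ] (s ≤ L v)
  singleton-⊑⁻ {ℕ.suc k} (s≤ ∷ _)  = zero , s≤
  singleton-⊑⁻ {ℕ.suc k} (_ ∷ʳ s⊑) = let v , s≤ = singleton-⊑⁻ s⊑ in suc v , s≤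

  cliqueCoverable? : ∀ s → Dec (CliqueCoverable TS s)
  -- Nothing is visited yet, so every word is still in the room left, `All U`.
  cliqueCoverable? s with search ⊑-wqoOn [] ((s ∷ []) ∷ []) (λ xs → inj₁ (All.universal (λ _ → _) xs))
  ... | inj₁ (here reached) =
    let k , L₀ , L , init , steps , s⊑ = reached⇒covered reached
    in yes ((complete k , L₀) , (complete k , L) , complete-isComplete k , init , steps , singleton-⊑⁻ s⊑)
  ... | inj₂ sat = no λ { (_ , _ , clique , init , steps , v , s≤) →
    unreachable sat clique init steps
      (Any.map (λ q⊑s → ⊑-trans q⊑s (singleton-⊑⁺ v s≤)) (All.head (Saturation.covers sat))) }

theorem20 : {n : ℕ} (TS : Process n) → Effective TS → InputEnabled TS →
    (s : Process.S TS) → Dec (CliqueCoverable TS s)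
theorem20 = cliqueCoverable?
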